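{- Let $G=(V,E)$ be an $n$-vertex undirected unweighted graph, let $H^*$ be a $(\beta,\epsilon)$-hopset for $G$, and let $G^*$ be a $t$-multiplicative spanner for $G$. Then one can compute a $(1+2\epsilon,\beta\cdot t)$-spanner $\widehat{G}\subseteq G$ with $O\left(t\,|H^*|\cdot\beta/\epsilon+|G^*|\right)$ edges.
   Context: Here $\beta\geq 1$ is an integer and $\epsilon\in(0,1)$. $\mathrm{dist}^{(\beta)}_{G'}(u,v)$ is the minimum length of a $u$-$v$ path in $G'$ with at most $\beta$ edges. A $(\beta,\epsilon)$-hopset for $G$ is a set $H\subseteq V\times V$ of weighted edges (each weighted by the shortest-path distance in $G$ between its endpoints) such that $\mathrm{dist}_G(u,v)\le \mathrm{dist}^{(\beta)}_{G\cup H}(u,v)\le(1+\epsilon)\mathrm{dist}_G(u,v)$ for all $u,v\in V$. An $(\alpha,\beta')$-spanner of $G$ is a subgraph $G'\subseteq G$ with $\mathrm{dist}_{G'}(u,v)\le\alpha\cdot\mathrm{dist}_G(u,v)+\beta'$ for all $u,v\in V$; a $t$-multiplicative spanner is a $(t,0)$-spanner. $|\cdot|$ denotes the number of edges. -}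

module Defs where

open import Algebra.Bundles using (CommutativeRing)
import Algebra.Definitions.RawMonoid as RawMonoidDefs
open import Data.Fin.Base as Fin using (Fin; zero; suc; toℕ)
import Data.Fin.Properties as Fin
open import Data.List.Base using (List; length; filter; cartesianProduct; allFin)
import Data.Maybe.Base as Maybe
open import Data.Nat.Base using (ℕ; zero; suc; _+_; _*_; _∸_; _≤_; _<_; z≤n; s≤s; s≤s⁻¹)
open import Data.Nat.Induction using (<-wellFounded)
import Data.Nat.Properties as ℕ
open import Data.Product.Base using (∃; ∃-syntax; _×_; _,_; proj₁; proj₂)
open import Data.Sum.Base using (_⊎_; inj₁; inj₂)
open import Induction.WellFounded using (Acc; acc)
open import Level using (0ℓ; _⊔_) renaming (suc to lsuc)
open import Relation.Binary.Core using (Rel)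
import Relation.Binary.Construct.Add.Supremum.NonStrict as AddSupremum
open import Relation.Binary.Definitions using (Decidable; Symmetric; Irreflexive)
open import Relation.Binary.PropositionalEquality
open import Relation.Binary.Structures using (IsTotalOrder)
open import Relation.Nullary using (¬_; Dec; yes; no; contradiction)
open import Relation.Nullary.Construct.Add.Supremum using (_⁺; ⊤⁺; [_]; ≡-dec)
open import Relation.Nullary.Decidable using (map′; _×-dec_; _⊎-dec_)

-- agda-stdlib has no real numbers.  The real parameters ε and t range over an
-- arbitrary Archimedean ordered field; classically ℝ is one, as is ℚ.

record ArchimedeanField c ℓ₁ ℓ₂ : Set (lsuc (c ⊔ ℓ₁ ⊔ ℓ₂)) where
  field
    commutativeRing : CommutativeRing c ℓ₁

  open CommutativeRing commutativeRing public
    renaming (_+_ to _+ᴷ_; _*_ to _*ᴷ_; -_ to -ᴷ_; _-_ to _-ᴷ_)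

  infix  4 _≤ᴷ_ _<ᴷ_
  infix  8 _⁻¹
  infixl 7 _/_

  fromℕ : ℕ → Carrier
  fromℕ n = RawMonoidDefs._×_ +-rawMonoid n 1#

  field
    _≤ᴷ_         : Rel Carrier ℓ₂
    isTotalOrder : IsTotalOrder _≈_ _≤ᴷ_
    +-monoʳ-≤    : ∀ z {x y} → x ≤ᴷ y → z +ᴷ x ≤ᴷ z +ᴷ y
    *-nonneg     : ∀ {x y} → 0# ≤ᴷ x → 0# ≤ᴷ y → 0# ≤ᴷ x *ᴷ y
    0≉1          : ¬ (0# ≈ 1#)
    -- Total for convenience; the value of 0# ⁻¹ is unconstrained.
    _⁻¹          : Carrier → Carrier
    *-inverseʳ   : ∀ {x} → ¬ (x ≈ 0#) → x *ᴷ x ⁻¹ ≈ 1#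
    archimedean  : ∀ x → ∃[ n ] x ≤ᴷ fromℕ n

  _<ᴷ_ : Rel Carrier (ℓ₁ ⊔ ℓ₂)
  x <ᴷ y = x ≤ᴷ y × ¬ (x ≈ y)

  _/_ : Carrier → Carrier → Carrier
  x / y = x *ᴷ y ⁻¹

-- ⊤⁺ : ℕ ⁺ plays the role of ∞, the minimum of the empty set.

IsMinimum : (ℕ → Set) → ℕ ⁺ → Set
IsMinimum P [ m ] = P m × (∀ k → P k → m ≤ k)
IsMinimum P ⊤⁺    = ∀ k → ¬ P k

least : ∀ {P : ℕ → Set} → (∀ k → Dec (P k)) → ∀ B →
        (∃[ m ] m < B × IsMinimum P [ m ]) ⊎ (∀ k → k < B → ¬ P k)
least P? zero = inj₂ λ _ ()
least P? (suc B) with least P? B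
... | inj₁ (m , m<B , min) = inj₁ (m , ℕ.m<n⇒m<1+n m<B , min)
... | inj₂ none with P? B
...   | yes pB = inj₁ (B , ℕ.≤-refl , pB , λ k pk → ℕ.≮⇒≥ λ k<B → none k k<B pk)
...   | no ¬pB = inj₂ λ k k<1+B pk → case-≤ k pk (ℕ.m≤n⇒m<n∨m≡n (s≤s⁻¹ k<1+B))
  where
  case-≤ : ∀ k → _ → k < B ⊎ k ≡ B → _
  case-≤ k  pk (inj₁ k<B)  = none k k<B pk
  case-≤ .B pk (inj₂ refl) = ¬pB pk

minimum : ∀ {P : ℕ → Set} → (∀ k → Dec (P k)) → ∀ B → (∀ k → P k → k ≤ B) →
          ∃[ m ] IsMinimum P m
minimum P? B bounded with least P? (suc B)
... | inj₁ (m , _ , min) = [ m ] , min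
... | inj₂ none          = ⊤⁺ , λ k pk → none k (s≤s (bounded k pk)) pk

-- Edge u v w : there is an edge of weight w from u to v.

record WeightedGraph (n : ℕ) : Set₁ where
  field
    Edge      : Fin n → Fin n → ℕ → Set
    edge?     : ∀ u v w → Dec (Edge u v w)
    maxWeight : ℕ
    ≤maxWeight : ∀ {u v w} → Edge u v w → w ≤ maxWeight

module _ {n : ℕ} (W : WeightedGraph n) where
  open WeightedGraph W

  infixr 5 _∷_

  -- Walk u v h ℓ : a walk from u to v with h edges and total weight ℓ.
  -- Deleting cycles increases neither h nor ℓ, so the minima below are the
  -- same whether or not vertices may repeat.

  data Walk : Fin n → Fin n → ℕ → ℕ → Set where
    []  : ∀ {u} → Walk u u 0 0
    _∷_ : ∀ {u x v w h ℓ} → Edge u x w → Walk x v h ℓ → Walk u v (suc h) (w + ℓ)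

  HopWalk : ℕ → Fin n → Fin n → ℕ → Set
  HopWalk β u v ℓ = ∃[ h ] h ≤ β × Walk u v h ℓ

  AnyWalk : Fin n → Fin n → ℕ → Set
  AnyWalk u v ℓ = ∃[ h ] Walk u v h ℓ

  hopWalk? : ∀ β u v ℓ → Dec (HopWalk β u v ℓ)
  hopWalk? zero u v ℓ = map′ to from ((u Fin.≟ v) ×-dec (ℓ ℕ.≟ 0))
    where
    to : u ≡ v × ℓ ≡ 0 → HopWalk 0 u v ℓ
    to (refl , refl) = 0 , z≤n , []
    from : HopWalk 0 u v ℓ → u ≡ v × ℓ ≡ 0
    from (_ , _ , []) = refl , refl
  hopWalk? (suc β) u v ℓ = map′ to from
    (((u Fin.≟ v) ×-dec (ℓ ℕ.≟ 0)) ⊎-dec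
     Fin.any? λ x → ℕ.anyUpTo? (λ w → edge? u x w ×-dec hopWalk? β x v (ℓ ∸ w)) (suc ℓ))
    where
    Step : Set
    Step = ∃[ x ] ∃[ w ] w < suc ℓ × Edge u x w × HopWalk β x v (ℓ ∸ w)
    to : (u ≡ v × ℓ ≡ 0) ⊎ Step → HopWalk (suc β) u v ℓ
    to (inj₁ (refl , refl)) = 0 , z≤n , []
    to (inj₂ (x , w , w<1+ℓ , e , h , h≤β , p)) =
      suc h , s≤s h≤β , subst (Walk u v (suc h)) (ℕ.m+[n∸m]≡n (s≤s⁻¹ w<1+ℓ)) (e ∷ p)
    from : HopWalk (suc β) u v ℓ → (u ≡ v × ℓ ≡ 0) ⊎ Step
    from (_ , _ , []) = inj₁ (refl , refl)
    from (suc h , 1+h≤1+β , _∷_ {x = x} {w = w} {ℓ = ℓ′} e p) =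
      inj₂ (x , w , s≤s (ℕ.m≤m+n w ℓ′) , e , h , s≤s⁻¹ 1+h≤1+β ,
            subst (Walk x v h) (sym (ℕ.m+n∸m≡n w ℓ′)) p)

  walk-bounded : ∀ {u v h ℓ} → Walk u v h ℓ → ℓ ≤ h * maxWeight
  walk-bounded []      = z≤n
  walk-bounded (e ∷ p) = ℕ.+-mono-≤ (≤maxWeight e) (walk-bounded p)

  hopDist-exists : ∀ β u v → ∃[ d ] IsMinimum (HopWalk β u v) d
  hopDist-exists β u v = minimum (hopWalk? β u v) (β * maxWeight)
    λ _ (_ , h≤β , p) → ℕ.≤-trans (walk-bounded p) (ℕ.*-monoˡ-≤ maxWeight h≤β)

  vertex : ∀ {u v h ℓ} → Walk u v h ℓ → Fin (suc h) → Fin n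
  vertex {u} _       zero    = u
  vertex     (_ ∷ p) (suc i) = vertex p i

  suffix : ∀ {u v h ℓ} (p : Walk u v h ℓ) i →
           ∃[ ℓ′ ] ℓ′ ≤ ℓ × Walk (vertex p i) v (h ∸ toℕ i) ℓ′
  suffix p zero = _ , ℕ.≤-refl , p
  suffix (_∷_ {w = w} e p) (suc i) =
    let ℓ′ , ℓ′≤ℓ , q = suffix p i in ℓ′ , ℕ.m≤n⇒m≤o+n w ℓ′≤ℓ , q

  cut : ∀ {u v h ℓ} (p : Walk u v h ℓ) i j → i Fin.< j → vertex p i ≡ vertex p j →
        ∃[ h′ ] ∃[ ℓ′ ] h′ < h × ℓ′ ≤ ℓ × Walk u v h′ ℓ′
  cut {v = v} {suc h} (e ∷ p) zero (suc j) _ eq =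
    let ℓ′ , ℓ′≤ℓ , q = suffix (e ∷ p) (suc j) in
    _ , ℓ′ , s≤s (ℕ.m∸n≤m h (toℕ j)) , ℓ′≤ℓ ,
    subst (λ x → Walk x v (h ∸ toℕ j) ℓ′) (sym eq) q
  cut (_∷_ {w = w} e p) (suc i) (suc j) i<j eq =
    let _ , _ , h′<h , ℓ′≤ℓ , q = cut p i j (s≤s⁻¹ i<j) eq in
    _ , _ , s≤s h′<h , ℕ.+-monoʳ-≤ w ℓ′≤ℓ , e ∷ q

  shorten : ∀ {u v h ℓ} → Acc _<_ h → Walk u v h ℓ → ∃[ ℓ′ ] ℓ′ ≤ ℓ × HopWalk n u v ℓ′
  shorten {h = h} (acc rec) p with h ℕ.≤? n
  ... | yes h≤n = _ , ℕ.≤-refl , h , h≤n , p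
  ... | no  h≰n =
    let i , j , i<j , eq       = Fin.pigeonhole (ℕ.m<n⇒m<1+n (ℕ.≰⇒> h≰n)) (vertex p)
        _ , _ , h′<h , ℓ′≤ℓ , q = cut p i j i<j eq
        ℓ″ , ℓ″≤ℓ′ , r          = shorten (rec h′<h) q
    in ℓ″ , ℕ.≤-trans ℓ″≤ℓ′ ℓ′≤ℓ , r

  weightedDist-exists : ∀ u v → ∃[ d ] IsMinimum (AnyWalk u v) d
  weightedDist-exists u v with hopDist-exists n u v
  ... | [ m ] , (h , _ , p) , min = [ m ] , (h , p) , λ k (_ , q) →
        let ℓ′ , ℓ′≤k , r = shorten (<-wellFounded _) q in ℕ.≤-trans (min ℓ′ r) ℓ′≤k
  ... | ⊤⁺ , none = ⊤⁺ , λ k (_ , q) →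
        let ℓ′ , _ , r = shorten (<-wellFounded _) q in none ℓ′ r

  hopDist : ℕ → Fin n → Fin n → ℕ ⁺
  hopDist β u v = proj₁ (hopDist-exists β u v)

  hopDist-isMinimum : ∀ β u v → IsMinimum (HopWalk β u v) (hopDist β u v)
  hopDist-isMinimum β u v = proj₂ (hopDist-exists β u v)

  weightedDist : Fin n → Fin n → ℕ ⁺
  weightedDist u v = proj₁ (weightedDist-exists u v)

  weightedDist-isMinimum : ∀ u v → IsMinimum (AnyWalk u v) (weightedDist u v)
  weightedDist-isMinimum u v = proj₂ (weightedDist-exists u v)

record Graph (n : ℕ) : Set₁ where
  infix 4 _~_
  field
    _~_    : Rel (Fin n) 0ℓ
    _~?_   : Decidable _~_
    ~-sym  : Symmetric _~_
    ~-irrefl : Irreflexive _≡_ _~_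

pairs : ∀ n → List (Fin n × Fin n)
pairs n = cartesianProduct (allFin n) (allFin n)

-- Each undirected edge {i , j} is counted once, as the pair with i < j.

∣_∣ᴳ : ∀ {n} → Graph n → ℕ
∣_∣ᴳ {n} G = length (filter (λ (i , j) → (i Fin.<? j) ×-dec (i ~? j)) (pairs n))
  where open Graph G

_⊆ᴳ_ : ∀ {n} → Graph n → Graph n → Set
G′ ⊆ᴳ G = ∀ {u v} → Graph._~_ G′ u v → Graph._~_ G u v

unitWeights : ∀ {n} → Graph n → WeightedGraph n
unitWeights G = record
  { Edge       = λ u v w → u ~ v × w ≡ 1
  ; edge?      = λ u v w → (u ~? v) ×-dec (w ℕ.≟ 1)
  ; maxWeight  = 1
  ; ≤maxWeight = λ (_ , w≡1) → ℕ.≤-reflexive w≡1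
  } where open Graph G

dist : ∀ {n} → Graph n → Fin n → Fin n → ℕ ⁺
dist G = weightedDist (unitWeights G)

-- A set H ⊆ V × V.  Every pair stands for an undirected edge between its
-- endpoints, so a set of undirected edges is given by orienting each of its
-- edges arbitrarily.

record EdgeSet (n : ℕ) : Set₁ where
  field
    _∈H_  : Rel (Fin n) 0ℓ
    _∈H?_ : Decidable _∈H_

∣_∣ᴴ : ∀ {n} → EdgeSet n → ℕ
∣_∣ᴴ {n} H = length (filter (λ (i , j) → i ∈H? j) (pairs n))
  where open EdgeSet H

private
  unit-walk-length : ∀ {n} (G : Graph n) {u v h ℓ} → Walk (unitWeights G) u v h ℓ → ℓ ≡ h
  unit-walk-length G []                = refl
  unit-walk-length G ((_ , refl) ∷ p) = cong suc (unit-walk-length G p)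

dist≤n : ∀ {n} (G : Graph n) u v {w} → dist G u v ≡ [ w ] → w ≤ n
dist≤n {n} G u v eq
  with (_ , p) , min ← subst (IsMinimum _) eq (weightedDist-isMinimum (unitWeights G) u v)
  with ℓ′ , _ , h , h≤n , q ← shorten (unitWeights G) (<-wellFounded _) p
  = ℕ.≤-trans (min ℓ′ (h , q)) (subst (_≤ n) (sym (unit-walk-length G q)) h≤n)

-- G ∪ H, with the edges of G of weight 1 and those of H weighted by dist G.
-- Pairs of H at distance ∞ in G lie on no walk of finite length and so
-- contribute no edge.

_∪_ : ∀ {n} → Graph n → EdgeSet n → WeightedGraph n
_∪_ {n} G H = record
  { Edge       = λ u v w → (u ~ v × w ≡ 1) ⊎ ((u ∈H v ⊎ v ∈H u) × dist G u v ≡ [ w ])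
  ; edge?      = λ u v w → ((u ~? v) ×-dec (w ℕ.≟ 1)) ⊎-dec
                           (((u ∈H? v) ⊎-dec (v ∈H? u)) ×-dec ≡-dec ℕ._≟_ (dist G u v) [ w ])
  ; maxWeight  = suc n
  ; ≤maxWeight = λ where
      (inj₁ (_ , refl)) → s≤s z≤n
      (inj₂ (_ , eq))   → ℕ.m≤n⇒m≤1+n (dist≤n G _ _ eq)
  }
  where
  open Graph G
  open EdgeSet H

module _ {c ℓ₁ ℓ₂} (K : ArchimedeanField c ℓ₁ ℓ₂) where
  open ArchimedeanField K
  open AddSupremum _≤ᴷ_ using () renaming (_≤⁺_ to _≤ᴷ⁺_)
  open AddSupremum _≤_ using (_≤⁺_)

  fromℕ⁺ : ℕ ⁺ → Carrier ⁺
  fromℕ⁺ = Maybe.map fromℕ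

  -- x ↦ α x + β, with ∞ ↦ ∞ for every α (including α ≈ 0#).
  affine : Carrier → Carrier → Carrier ⁺ → Carrier ⁺
  affine α β = Maybe.map (λ x → α *ᴷ x +ᴷ β)

  IsHopset : ∀ {n} → ℕ → Carrier → Graph n → EdgeSet n → Set (c ⊔ ℓ₂)
  IsHopset β ε G H = ∀ u v →
    dist G u v ≤⁺ hopDist (G ∪ H) β u v ×
    fromℕ⁺ (hopDist (G ∪ H) β u v) ≤ᴷ⁺ affine (1# +ᴷ ε) 0# (fromℕ⁺ (dist G u v))

  IsSpanner : ∀ {n} → Carrier → Carrier → Graph n → Graph n → Set (c ⊔ ℓ₂)
  IsSpanner α β G G′ =
    G′ ⊆ᴳ G ×
    (∀ u v → fromℕ⁺ (dist G′ u v) ≤ᴷ⁺ affine α β (fromℕ⁺ (dist G u v)))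

  IsMultiplicativeSpanner : ∀ {n} → Carrier → Graph n → Graph n → Set (c ⊔ ℓ₂)
  IsMultiplicativeSpanner t = IsSpanner t 0#

{-# OPTIONS --safe #-}

-- Let Ĝ consist of G* and, for every pair of H* joined by a path of at most 2Δ edges in G, one
-- such shortest path; here Δ is an integer with Δ - 1 ≤ βt/ε ≤ Δ.  If u and v are joined by
-- a walk of length d ≤ Δ in G, then the hopset walk from u to v has length at most
-- (1 + ε)d ≤ 2Δ, so each of its H*-edges is realised exactly in Ĝ, while each of its at most β
-- G-edges is replaced by a walk of length at most t in G*: the result has length at most
-- (1 + ε)d + βt.  A longer walk is cut into pieces of length Δ and a remainder.  On a
-- piece of length Δ the additive error βt is at most εΔ, so only the remainder pays it.
-- If G has an edge then t ≥ 1, hence Δ = O(βt/ε), and Ĝ has at most |G*| + O(Δ|H*|) edges.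

module Submission where

open import Defs
open import Data.Nat using (ℕ; _≤_)
open import Data.Product using (_×_; ∃-syntax)

import Algebra.Properties.AbelianGroup as AbelianGroupProperties
import Algebra.Properties.Ring as RingProperties
import Algebra.Properties.Semiring.Mult as SemiringMult
import Algebra.Solver.Ring.NaturalCoefficients.Default as SemiringSolver
open import Data.Fin.Base as Fin using (Fin)
import Data.Fin.Properties as Fin
open import Data.List.Base using (List; []; _∷_; _++_; length; map; filter; concatMap; allFin)
open import Data.List.Membership.Propositional using (_∈_; lose)
open import Data.List.Membership.Propositional.Properties
  using (∈-∃++; ∈-++⁺ˡ; ∈-++⁺ʳ; ∈-++⁻; ∈-filter⁺; ∈-filter⁻; ∈-map⁺;
         ∈-concatMap⁺; ∈-concatMap⁻; ∈-cartesianProduct⁺; ∈-allFin)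
open import Data.List.Properties using (length-++; length-++-sucʳ; length-map)
open import Data.List.Relation.Binary.Subset.Propositional using (_⊆_)
import Data.List.Relation.Unary.All as All
open import Data.List.Relation.Unary.AllPairs using ([]; _∷_)
open import Data.List.Relation.Unary.Any using (here; there; satisfied)
open import Data.List.Relation.Unary.Unique.Propositional using (Unique)
import Data.List.Relation.Unary.Unique.Propositional.Properties as Unique
open import Data.Nat.Base using (zero; suc; _+_; _*_; _<_; z≤n; s≤s)
open import Data.Nat.Induction using (<-wellFounded)
import Data.Nat.Properties as ℕ
import Data.Nat.Solver as ℕ-Solver
open import Data.Product.Base using (∃; _,_; proj₁; proj₂; swap)
open import Data.Product.Properties using (≡-dec)
open import Data.Sum.Base using (_⊎_; inj₁; inj₂; [_,_]′)
import Data.Sum.Base as Sum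
open import Function.Base using (_∘_; id)
open import Induction.WellFounded using (Acc; acc)
open import Relation.Binary.Bundles using (Poset)
import Relation.Binary.Construct.Add.Supremum.NonStrict as AddSupremum
open import Relation.Binary.PropositionalEquality
  using (_≡_; refl; sym; trans; cong; subst)
import Relation.Binary.Reasoning.PartialOrder as PartialOrderReasoning
open import Relation.Binary.Structures using (IsTotalOrder)
open import Relation.Nullary using (¬_; Dec; yes; no; contradiction)
open import Relation.Nullary.Construct.Add.Supremum using (⊤⁺; [_])
open import Relation.Nullary.Decidable using (_⊎-dec_; _×-dec_)

-- Lists

module _ {a} {A : Set a} where

  -- Deleting one occurrence of the head from `ys` keeps the tail covered, because the head does not
  -- recur in `xs`. The edge counts below rest on this; `ys` may contain repetitions.
  Unique-⊆⇒length-≤ : ∀ {xs ys : List A} → Unique xs → xs ⊆ ys → length xs ≤ length ys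
  Unique-⊆⇒length-≤ [] _ = z≤n
  Unique-⊆⇒length-≤ {x ∷ xs} (x∉xs ∷ xs!) x∷xs⊆ys
    with as , bs , refl ← ∈-∃++ (x∷xs⊆ys (here refl)) = begin
      suc (length xs)          ≤⟨ s≤s (Unique-⊆⇒length-≤ xs! xs⊆as++bs) ⟩
      suc (length (as ++ bs))  ≡⟨ length-++-sucʳ as x bs ⟨
      length (as ++ x ∷ bs)    ∎
    where
    open ℕ.≤-Reasoning
    xs⊆as++bs : xs ⊆ as ++ bs
    xs⊆as++bs y∈xs with ∈-++⁻ as (x∷xs⊆ys (there y∈xs))
    ... | inj₁ y∈as          = ∈-++⁺ˡ y∈as
    ... | inj₂ (here refl)   = contradiction refl (All.lookup x∉xs y∈xs)
    ... | inj₂ (there y∈bs)  = ∈-++⁺ʳ as y∈bs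

  length-concatMap-≤ : ∀ {b} {B : Set b} (f : A → List B) {m} → (∀ x → length (f x) ≤ m) →
                       ∀ xs → length (concatMap f xs) ≤ length xs * m
  length-concatMap-≤ f f≤m []       = z≤n
  length-concatMap-≤ f f≤m (x ∷ xs) = subst (_≤ _) (sym (length-++ (f x)))
    (ℕ.+-mono-≤ (f≤m x) (length-concatMap-≤ f f≤m xs))

-- Walks

module _ {n} {W : WeightedGraph n} where

  infixr 5 _++ʷ_

  -- Formulated for `AnyWalk`, so that the number of edges stays hidden and only lengths are added.
  _++ʷ_ : ∀ {u x v k m} → AnyWalk W u x k → AnyWalk W x v m → AnyWalk W u v (k + m)
  (_ , []) ++ʷ q = q
  _++ʷ_ {m = m} (_ , _∷_ {w = w} {ℓ = ℓ} e p) q =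
    _ , subst (Walk W _ _ _) (sym (ℕ.+-assoc w ℓ m)) (e ∷ proj₂ ((_ , p) ++ʷ q))

  reverseWalk : (∀ {u v w} → WeightedGraph.Edge W u v w → WeightedGraph.Edge W v u w) →
                ∀ {u v k} → AnyWalk W u v k → AnyWalk W v u k
  reverseWalk flip (_ , []) = _ , []
  reverseWalk flip (_ , _∷_ {w = w} {ℓ = ℓ} e p) =
    subst (AnyWalk W _ _) (trans (cong (ℓ +_) (ℕ.+-identityʳ w)) (ℕ.+-comm ℓ w))
      (reverseWalk flip (_ , p) ++ʷ (_ , flip e ∷ []))

-- Paths in an unweighted graph

Path : ∀ {n} → Graph n → Fin n → Fin n → ℕ → Set
Path G = AnyWalk (unitWeights G)

module _ {n} (G : Graph n) where
  open Graph G

  reversePath : ∀ {u v k} → Path G u v k → Path G v u k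
  reversePath = reverseWalk λ (u~v , w≡1) → ~-sym u~v , w≡1

  -- Turns a bound on the length of a path into the bound on its number of edges that `HopWalk` asks
  -- for.
  unitWalk-length : ∀ {u v h ℓ} → Walk (unitWeights G) u v h ℓ → h ≡ ℓ
  unitWalk-length []               = refl
  unitWalk-length ((_ , refl) ∷ p) = cong suc (unitWalk-length p)

  edgePath : ∀ {u v} → u ~ v → Path G u v 1
  edgePath u~v = _ , (u~v , refl) ∷ []

  Path-0⇒≡ : ∀ {u v} → Path G u v 0 → u ≡ v
  Path-0⇒≡ (zero  , []) = refl
  Path-0⇒≡ (suc _ , p)  = contradiction (unitWalk-length p) λ ()

  -- Every edge has length 1, so a path passes through each intermediate length and can be cut
  -- exactly at `k`.
  splitPath : ∀ k {m u v} → Path G u v (k + m) → ∃[ x ] Path G u x k × Path G x v m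
  splitPath k (_ , p) = split k p refl
    where
    split : ∀ k {m u v h ℓ} → Walk (unitWeights G) u v h ℓ → ℓ ≡ k + m →
            ∃[ x ] Path G u x k × Path G x v m
    split zero    p refl = _ , (_ , []) , (_ , p)
    split (suc k) (e@(_ , refl) ∷ p) eq =
      let x , (_ , q) , r = split k p (ℕ.suc-injective eq) in x , (_ , e ∷ q) , r

  walkEdges : ∀ {u v h ℓ} → Walk (unitWeights G) u v h ℓ → List (Fin n × Fin n)
  walkEdges [] = []
  walkEdges (_∷_ {u = u} {x = x} _ p) = (u , x) ∷ walkEdges p

  length-walkEdges : ∀ {u v h ℓ} (p : Walk (unitWeights G) u v h ℓ) → length (walkEdges p) ≡ h
  length-walkEdges []      = refl
  length-walkEdges (_ ∷ p) = cong suc (length-walkEdges p)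

  ∈-walkEdges⇒~ : ∀ {u v h ℓ} (p : Walk (unitWeights G) u v h ℓ) {x y} →
                  (x , y) ∈ walkEdges p → x ~ y
  ∈-walkEdges⇒~ ((u~x , _) ∷ p) (here refl) = u~x
  ∈-walkEdges⇒~ (_ ∷ p)         (there xy∈) = ∈-walkEdges⇒~ p xy∈

  transportWalk : ∀ (G′ : Graph n) {u v h ℓ} (p : Walk (unitWeights G) u v h ℓ) →
                  (∀ {x y} → (x , y) ∈ walkEdges p → Graph._~_ G′ x y) → Path G′ u v ℓ
  transportWalk G′ []              _   = _ , []
  transportWalk G′ ((_ , w≡1) ∷ p) all =
    _ , (all (here refl) , w≡1) ∷ proj₂ (transportWalk G′ p (all ∘ there))

Path-mono : ∀ {n} (G G′ : Graph n) → G ⊆ᴳ G′ → ∀ {u v k} → Path G u v k → Path G′ u v k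
Path-mono G G′ G⊆G′ (_ , p) = transportWalk G G′ p (G⊆G′ ∘ ∈-walkEdges⇒~ G p)

-- Shortest paths with a bounded number of edges

module _ {n} (G : Graph n) (D : ℕ) where

  private
    W = unitWeights G

    -- The minimum comes with its proof, so that a walk attaining it is at hand and the lemmas below
    -- can split on both cases.
    edgesOf : ∀ {u v} → ∃ (IsMinimum (HopWalk W D u v)) → List (Fin n × Fin n)
    edgesOf ([ _ ] , (_ , _ , p) , _) = walkEdges G p
    edgesOf (⊤⁺ , _)                  = []

  -- A shortest among the walks of at most `D` edges is a shortest path of `G` whenever the distance
  -- is at most `D`; the restriction also bounds the length of the list.
  shortPathEdges : Fin n × Fin n → List (Fin n × Fin n)
  shortPathEdges (u , v) = edgesOf (hopDist-exists W D u v)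

  length-shortPathEdges : ∀ uv → length (shortPathEdges uv) ≤ D
  length-shortPathEdges (u , v) = go (hopDist-exists W D u v)
    where
    go : ∀ d → length (edgesOf d) ≤ D
    go ([ _ ] , (_ , h≤D , p) , _) = ℕ.≤-trans (ℕ.≤-reflexive (length-walkEdges G p)) h≤D
    go (⊤⁺ , _)                    = z≤n

  ∈-shortPathEdges⇒~ : ∀ uv {x y} → (x , y) ∈ shortPathEdges uv → Graph._~_ G x y
  ∈-shortPathEdges⇒~ (u , v) = go (hopDist-exists W D u v)
    where
    go : ∀ d {x y} → (x , y) ∈ edgesOf d → Graph._~_ G x y
    go ([ _ ] , (_ , _ , p) , _) = ∈-walkEdges⇒~ G p
    go (⊤⁺ , _)                  ()

  -- A path of length `k ≤ D` has `k` edges, so it competes in the minimum that selected the listed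
  -- walk. That walk is therefore no longer, and it survives in every graph containing its edges.
  shortPathEdges-path : ∀ (G′ : Graph n) {u v} →
    (∀ {x y} → (x , y) ∈ shortPathEdges (u , v) → Graph._~_ G′ x y) →
    ∀ {k} → k ≤ D → Path G u v k → ∃[ m ] m ≤ k × Path G′ u v m
  shortPathEdges-path G′ {u} {v} all {k} k≤D (h , p) = go (hopDist-exists W D u v) all
    where
    short : HopWalk W D u v k
    short = h , subst (_≤ D) (sym (unitWalk-length G p)) k≤D , p
    go : ∀ d → (∀ {x y} → (x , y) ∈ edgesOf d → Graph._~_ G′ x y) →
         ∃[ m ] m ≤ k × Path G′ u v m
    go ([ m ] , (_ , _ , q) , min) all = m , min _ short , transportWalk G G′ q all
    go (⊤⁺ , none)                 _   = contradiction short (none _)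

-- Counting edges, and adding a list of edges to a graph

module _ {n : ℕ} where

  allPairs! : Unique (pairs n)
  allPairs! = Unique.cartesianProduct⁺ (Unique.allFin⁺ n) (Unique.allFin⁺ n)

  ∈-pairs : ∀ u v → (u , v) ∈ pairs n
  ∈-pairs u v = ∈-cartesianProduct⁺ (∈-allFin u) (∈-allFin v)

  orderedEdge? : ∀ (G : Graph n) (uv : Fin n × Fin n) →
                 Dec (proj₁ uv Fin.< proj₂ uv × Graph._~_ G (proj₁ uv) (proj₂ uv))
  orderedEdge? G (i , j) = (i Fin.<? j) ×-dec Graph._~?_ G i j

  -- The count is the length of a filtered list without repetitions, so `Unique-⊆⇒length-≤` applies.
  ⊆⇒∣∣-≤ : ∀ (G : Graph n) {es} →
           (∀ {u v} → u Fin.< v → Graph._~_ G u v → (u , v) ∈ es) → ∣ G ∣ᴳ ≤ length es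
  ⊆⇒∣∣-≤ G cover = Unique-⊆⇒length-≤ (Unique.filter⁺ (orderedEdge? G) allPairs!) λ uv∈ →
    let _ , u<v , u~v = ∈-filter⁻ (orderedEdge? G) {xs = pairs n} uv∈ in cover u<v u~v

  module _ (G : Graph n) (es : List (Fin n × Fin n))
           (irrefl : ∀ {u} → ¬ (u , u) ∈ es) where
    open Graph G
    open import Data.List.Membership.DecPropositional (≡-dec (Fin._≟_ {n}) (Fin._≟_ {n}))
      using (_∈?_)

    addEdges : Graph n
    addEdges = record
      { _~_      = λ u v → u ~ v ⊎ (u , v) ∈ es ⊎ (v , u) ∈ es
      ; _~?_     = λ u v → (u ~? v) ⊎-dec ((u , v) ∈? es) ⊎-dec ((v , u) ∈? es)
      ; ~-sym    = Sum.map ~-sym Sum.swap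
      ; ~-irrefl = λ { refl → [ ~-irrefl refl , [ irrefl , irrefl ]′ ]′ }
      }

    -- An added pair may point either way, while the count only sees pairs with `u < v`. The cover
    -- therefore contains `es` and its reversal, which doubles `length es`.
    ∣addEdges∣-≤ : ∣ addEdges ∣ᴳ ≤ ∣ G ∣ᴳ + (length es + length es)
    ∣addEdges∣-≤ = subst (∣ addEdges ∣ᴳ ≤_) length-cover (⊆⇒∣∣-≤ addEdges covered)
      where
      old = filter (orderedEdge? G) (pairs n)
      length-cover : length (old ++ es ++ map swap es) ≡ ∣ G ∣ᴳ + (length es + length es)
      length-cover = trans (length-++ old) (cong (length old +_)
        (trans (length-++ es) (cong (length es +_) (length-map swap es))))
      covered : ∀ {u v} → u Fin.< v → Graph._~_ addEdges u v →
                (u , v) ∈ old ++ es ++ map swap es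
      covered u<v (inj₁ u~v) = ∈-++⁺ˡ (∈-filter⁺ (orderedEdge? G) (∈-pairs _ _) (u<v , u~v))
      covered u<v (inj₂ (inj₁ uv∈)) = ∈-++⁺ʳ old (∈-++⁺ˡ uv∈)
      covered u<v (inj₂ (inj₂ vu∈)) = ∈-++⁺ʳ old (∈-++⁺ʳ es (∈-map⁺ swap vu∈))

-- Archimedean fields

module FieldProperties {c ℓ₁ ℓ₂} (K : ArchimedeanField c ℓ₁ ℓ₂) where
  open ArchimedeanField K
    hiding (refl; sym; trans; zero)
  open ArchimedeanField K public using ()
    renaming (refl to ≈-refl; sym to ≈-sym; trans to ≈-trans)
  open IsTotalOrder isTotalOrder public using ()
    renaming (refl to ≤ᴷ-refl; reflexive to ≤ᴷ-reflexive; trans to ≤ᴷ-trans;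
              antisym to ≤ᴷ-antisym; total to ≤ᴷ-total; isPartialOrder to ≤ᴷ-isPartialOrder)
  open AbelianGroupProperties +-abelianGroup using (\\-leftDividesʳ; xyx⁻¹≈y; ⁻¹-involutive)
  open RingProperties ring using (-1*x≈-x)
  open SemiringMult semiring using (×-homo-+; ×1-homo-*)
  module Solver = SemiringSolver commutativeSemiring

  poset : Poset c ℓ₁ ℓ₂
  poset = record { isPartialOrder = ≤ᴷ-isPartialOrder }

  open PartialOrderReasoning poset

  +ᴷ-mono-≤ : ∀ {x y z w} → x ≤ᴷ y → z ≤ᴷ w → x +ᴷ z ≤ᴷ y +ᴷ w
  +ᴷ-mono-≤ {x} {y} {z} {w} x≤y z≤w = begin
    x +ᴷ z  ≤⟨ +-monoʳ-≤ x z≤w ⟩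
    x +ᴷ w  ≈⟨ +-comm x w ⟩
    w +ᴷ x  ≤⟨ +-monoʳ-≤ w x≤y ⟩
    w +ᴷ y  ≈⟨ +-comm w y ⟩
    y +ᴷ w  ∎

  +ᴷ-cancelˡ-≤ : ∀ z {x y} → z +ᴷ x ≤ᴷ z +ᴷ y → x ≤ᴷ y
  +ᴷ-cancelˡ-≤ z {x} {y} z+x≤z+y = begin
    x                    ≈⟨ \\-leftDividesʳ z x ⟨
    (-ᴷ z) +ᴷ (z +ᴷ x)   ≤⟨ +-monoʳ-≤ (-ᴷ z) z+x≤z+y ⟩
    (-ᴷ z) +ᴷ (z +ᴷ y)   ≈⟨ \\-leftDividesʳ z y ⟩
    y                    ∎

  x≤x+y : ∀ {x y} → 0# ≤ᴷ y → x ≤ᴷ x +ᴷ y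
  x≤x+y {x} {y} 0≤y = begin
    x        ≈⟨ +-identityʳ x ⟨
    x +ᴷ 0#  ≤⟨ +-monoʳ-≤ x 0≤y ⟩
    x +ᴷ y   ∎

  +-nonneg : ∀ {x y} → 0# ≤ᴷ x → 0# ≤ᴷ y → 0# ≤ᴷ x +ᴷ y
  +-nonneg 0≤x 0≤y = ≤ᴷ-trans 0≤x (x≤x+y 0≤y)

  x≤y⇒0≤y-x : ∀ {x y} → x ≤ᴷ y → 0# ≤ᴷ y -ᴷ x
  x≤y⇒0≤y-x {x} {y} x≤y = +ᴷ-cancelˡ-≤ x (begin
    x +ᴷ 0#          ≈⟨ +-identityʳ x ⟩
    x                ≤⟨ x≤y ⟩
    y                ≈⟨ xyx⁻¹≈y x y ⟨
    x +ᴷ y -ᴷ x      ≈⟨ +-assoc x y (-ᴷ x) ⟩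
    x +ᴷ (y -ᴷ x)    ∎)

  -- The order axioms govern products only through `*-nonneg`, which is applied here to `z` and the
  -- difference of `y` and `x`.
  *ᴷ-monoʳ-≤ : ∀ {z x y} → 0# ≤ᴷ z → x ≤ᴷ y → z *ᴷ x ≤ᴷ z *ᴷ y
  *ᴷ-monoʳ-≤ {z} {x} {y} 0≤z x≤y = begin
    z *ᴷ x                   ≤⟨ x≤x+y (*-nonneg 0≤z (x≤y⇒0≤y-x x≤y)) ⟩
    z *ᴷ x +ᴷ z *ᴷ (y -ᴷ x)  ≈⟨ distribˡ z x (y -ᴷ x) ⟨
    z *ᴷ (x +ᴷ (y -ᴷ x))     ≈⟨ *-congˡ (+-assoc x y (-ᴷ x)) ⟨
    z *ᴷ (x +ᴷ y -ᴷ x)       ≈⟨ *-congˡ (xyx⁻¹≈y x y) ⟩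
    z *ᴷ y                   ∎

  *ᴷ-monoˡ-≤ : ∀ {z x y} → 0# ≤ᴷ z → x ≤ᴷ y → x *ᴷ z ≤ᴷ y *ᴷ z
  *ᴷ-monoˡ-≤ {z} {x} {y} 0≤z x≤y = begin
    x *ᴷ z  ≈⟨ *-comm x z ⟩
    z *ᴷ x  ≤⟨ *ᴷ-monoʳ-≤ 0≤z x≤y ⟩
    z *ᴷ y  ≈⟨ *-comm z y ⟩
    y *ᴷ z  ∎

  -- If 1 were at most 0, then -1 would be nonnegative, and so would its square, which is 1.
  0≤1 : 0# ≤ᴷ 1#
  0≤1 with ≤ᴷ-total 0# 1#
  ... | inj₁ 0≤1 = 0≤1
  ... | inj₂ 1≤0 = begin
    0#                      ≤⟨ *-nonneg 0≤-1 0≤-1 ⟩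
    (-ᴷ 1#) *ᴷ (-ᴷ 1#)      ≈⟨ -1*x≈-x (-ᴷ 1#) ⟩
    -ᴷ (-ᴷ 1#)              ≈⟨ ⁻¹-involutive 1# ⟩
    1#                      ∎
    where
    0≤-1 : 0# ≤ᴷ -ᴷ 1#
    0≤-1 = begin
      0#        ≤⟨ x≤y⇒0≤y-x 1≤0 ⟩
      0# -ᴷ 1#  ≈⟨ +-identityˡ _ ⟩
      -ᴷ 1#     ∎

  1≰0 : ¬ 1# ≤ᴷ 0#
  1≰0 1≤0 = 0≉1 (≤ᴷ-antisym 0≤1 1≤0)

  fromℕ-+ : ∀ m k → fromℕ (m + k) ≈ fromℕ m +ᴷ fromℕ k
  fromℕ-+ = ×-homo-+ 1#

  fromℕ-* : ∀ m k → fromℕ (m * k) ≈ fromℕ m *ᴷ fromℕ k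
  fromℕ-* = ×1-homo-*

  0≤fromℕ : ∀ m → 0# ≤ᴷ fromℕ m
  0≤fromℕ zero    = ≤ᴷ-refl
  0≤fromℕ (suc m) = +-nonneg 0≤1 (0≤fromℕ m)

  fromℕ-mono-≤ : ∀ {m k} → m ≤ k → fromℕ m ≤ᴷ fromℕ k
  fromℕ-mono-≤ {k = k} z≤n = 0≤fromℕ k
  fromℕ-mono-≤ (s≤s m≤k)   = +-monoʳ-≤ 1# (fromℕ-mono-≤ m≤k)

  fromℕ-cancel-≤ : ∀ {m k} → fromℕ m ≤ᴷ fromℕ k → m ≤ k
  fromℕ-cancel-≤ {zero}          _   = z≤n
  fromℕ-cancel-≤ {suc m} {zero}  1+m≤0 = contradiction (≤ᴷ-trans (x≤x+y (0≤fromℕ m)) 1+m≤0) 1≰0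
  fromℕ-cancel-≤ {suc m} {suc k} m≤k = s≤s (fromℕ-cancel-≤ {m} {k} (+ᴷ-cancelˡ-≤ 1# m≤k))

  1≤fromℕ : ∀ {m} → 1 ≤ m → 1# ≤ᴷ fromℕ m
  1≤fromℕ {m} 1≤m = begin
    1#       ≈⟨ +-identityʳ 1# ⟨
    fromℕ 1  ≤⟨ fromℕ-mono-≤ 1≤m ⟩
    fromℕ m  ∎

  -- A downward search from an Archimedean bound. It branches on totality of the order, so both
  -- bounds are weak, and at a positive integer `x` the result may be `x` or its predecessor.
  floor : ∀ {x} → 0# ≤ᴷ x → ∃[ k ] fromℕ k ≤ᴷ x × x ≤ᴷ fromℕ (suc k)
  floor {x} 0≤x = let m , x≤m = archimedean x in search m x≤m
    where
    search : ∀ m → x ≤ᴷ fromℕ m → ∃[ k ] fromℕ k ≤ᴷ x × x ≤ᴷ fromℕ (suc k)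
    search zero    x≤0 = 0 , 0≤x , ≤ᴷ-trans x≤0 (0≤fromℕ 1)
    search (suc m) x≤1+m with ≤ᴷ-total x (fromℕ m)
    ... | inj₁ x≤m = search m x≤m
    ... | inj₂ m≤x = m , m≤x , x≤1+m

  module _ {x} (0<x : 0# <ᴷ x) where

    private
      x*x⁻¹≈1 : x *ᴷ x ⁻¹ ≈ 1#
      x*x⁻¹≈1 = *-inverseʳ (proj₂ 0<x ∘ ≈-sym)

    -- A nonpositive inverse would make the product with `x`, which is 1, nonpositive.
    0≤x⁻¹ : 0# ≤ᴷ x ⁻¹
    0≤x⁻¹ with ≤ᴷ-total 0# (x ⁻¹)
    ... | inj₁ 0≤x⁻¹ = 0≤x⁻¹
    ... | inj₂ x⁻¹≤0 = contradiction (begin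
      1#           ≈⟨ x*x⁻¹≈1 ⟨
      x *ᴷ x ⁻¹    ≤⟨ *ᴷ-monoʳ-≤ (proj₁ 0<x) x⁻¹≤0 ⟩
      x *ᴷ 0#      ≈⟨ zeroʳ x ⟩
      0#           ∎) 1≰0

    y/x*x≈y : ∀ y → y / x *ᴷ x ≈ y
    y/x*x≈y y = begin-equality
      y *ᴷ x ⁻¹ *ᴷ x    ≈⟨ *-assoc y (x ⁻¹) x ⟩
      y *ᴷ (x ⁻¹ *ᴷ x)  ≈⟨ *-congˡ (≈-trans (*-comm (x ⁻¹) x) x*x⁻¹≈1) ⟩
      y *ᴷ 1#           ≈⟨ *-identityʳ y ⟩
      y                 ∎

    1≤y/x : x ≤ᴷ 1# → ∀ {y} → 1# ≤ᴷ y → 1# ≤ᴷ y / x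
    1≤y/x x≤1 {y} 1≤y = begin
      1#            ≈⟨ x*x⁻¹≈1 ⟨
      x *ᴷ x ⁻¹     ≤⟨ *ᴷ-monoˡ-≤ 0≤x⁻¹ (≤ᴷ-trans x≤1 1≤y) ⟩
      y *ᴷ x ⁻¹     ∎

-- Spanners and hopsets

module _ {c ℓ₁ ℓ₂} (K : ArchimedeanField c ℓ₁ ℓ₂) where
  open ArchimedeanField K hiding (refl; sym; trans; zero)
  open FieldProperties K
  open PartialOrderReasoning poset
  open AddSupremum _≤ᴷ_ using () renaming (_≤⁺_ to _≤ᴷ⁺_; [_] to [_]⁺; _≤⊤⁺ to _≤⊤⁺ᴷ)

  -- Lets the estimates speak of actual walks; comparisons of possibly infinite distances are then
  -- confined to `affine-bound⁻` and `affine-bound⁺`.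
  Attains : (ℕ → Set) → Carrier → Set ℓ₂
  Attains P x = ∃[ m ] P m × fromℕ m ≤ᴷ x

  Attains-weaken : ∀ {P x y} → x ≤ᴷ y → Attains P x → Attains P y
  Attains-weaken x≤y (m , Pm , m≤x) = m , Pm , ≤ᴷ-trans m≤x x≤y

  module _ {P Q : ℕ → Set} {α b : Carrier} where

    -- Since `α` is nonnegative, the bound at the minimum `d` passes to every larger `k`. An
    -- infinite `d` would exclude `P k`.
    affine-bound⁻ : ∀ {d e} → 0# ≤ᴷ α → IsMinimum P d → IsMinimum Q e →
      fromℕ⁺ K e ≤ᴷ⁺ affine K α b (fromℕ⁺ K d) → ∀ {k} → P k → Attains Q (α *ᴷ fromℕ k +ᴷ b)
    affine-bound⁻ {[ d ]} {[ e ]} 0≤α (_ , min) (Qe , _) [ e≤αd+b ]⁺ Pk =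
      e , Qe , ≤ᴷ-trans e≤αd+b (+ᴷ-mono-≤ (*ᴷ-monoʳ-≤ 0≤α (fromℕ-mono-≤ (min _ Pk))) ≤ᴷ-refl)
    affine-bound⁻ {⊤⁺} _ none _ _ Pk = contradiction Pk (none _)

    -- It suffices to use the last hypothesis at the minimiser `d`; the member of `Q` found there
    -- also shows that `e` is finite.
    affine-bound⁺ : ∀ {d e} → IsMinimum P d → IsMinimum Q e →
      (∀ {k} → P k → Attains Q (α *ᴷ fromℕ k +ᴷ b)) →
      fromℕ⁺ K e ≤ᴷ⁺ affine K α b (fromℕ⁺ K d)
    affine-bound⁺ {⊤⁺}              _ _ _ = _ ≤⊤⁺ᴷ
    affine-bound⁺ {[ d ]} {[ e ]} (Pd , _) (_ , min) attains =
      let m , Qm , m≤ = attains Pd in [ ≤ᴷ-trans (fromℕ-mono-≤ (min m Qm)) m≤ ]⁺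
    affine-bound⁺ {[ d ]} {⊤⁺} (Pd , _) none attains =
      let m , Qm , _ = attains Pd in contradiction Qm (none m)

  module _ {n} (G : Graph n) {α b : Carrier} where

    spanner-path : ∀ {G′} → 0# ≤ᴷ α → IsSpanner K α b G G′ →
      ∀ {u v k} → Path G u v k → Attains (Path G′ u v) (α *ᴷ fromℕ k +ᴷ b)
    spanner-path {G′} 0≤α (_ , bound) {u} {v} = affine-bound⁻ 0≤α
      (weightedDist-isMinimum (unitWeights G) u v) (weightedDist-isMinimum (unitWeights G′) u v)
      (bound u v)

    path⇒spanner : ∀ {G′} → G′ ⊆ᴳ G →
      (∀ {u v k} → Path G u v k → Attains (Path G′ u v) (α *ᴷ fromℕ k +ᴷ b)) →
      IsSpanner K α b G G′
    path⇒spanner {G′} G′⊆G attains = G′⊆G , λ u v → affine-bound⁺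
      (weightedDist-isMinimum (unitWeights G) u v) (weightedDist-isMinimum (unitWeights G′) u v)
      attains

  hopset-path : ∀ {n} {G : Graph n} {β ε} {H : EdgeSet n} → 0# ≤ᴷ ε → IsHopset K β ε G H →
    ∀ {u v k} → Path G u v k → Attains (HopWalk (G ∪ H) β u v) ((1# +ᴷ ε) *ᴷ fromℕ k +ᴷ 0#)
  hopset-path {G = G} {β} {H = H} 0≤ε hopset {u} {v} = affine-bound⁻ (+-nonneg 0≤1 0≤ε)
    (weightedDist-isMinimum (unitWeights G) u v) (hopDist-isMinimum (G ∪ H) β u v)
    (proj₂ (hopset u v))

  multiplicativeSpanner-edge : ∀ {n} {G G′ : Graph n} {t} → 0# ≤ᴷ t →
    IsMultiplicativeSpanner K t G G′ → ∀ {u v} → Graph._~_ G u v → Attains (Path G′ u v) t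
  multiplicativeSpanner-edge {G = G} {G′} {t} 0≤t spanner u~v =
    Attains-weaken (≤ᴷ-reflexive t*1+0≈t) (spanner-path G {G′ = G′} 0≤t spanner (edgePath G u~v))
    where
    open Solver
    t*1+0≈t : t *ᴷ fromℕ 1 +ᴷ 0# ≈ t
    t*1+0≈t = solve 1 (λ t → t :* (con 1 :+ con 0) :+ con 0 := t) ≈-refl t

  -- The endpoints of an edge are distinct, so the path replacing it has length at least 1, and this
  -- length is at most `t`.
  1≤stretch : ∀ {n} {G G′ : Graph n} {t} → 0# ≤ᴷ t → IsMultiplicativeSpanner K t G G′ →
              ∀ {u v} → Graph._~_ G u v → 1# ≤ᴷ t
  1≤stretch {G = G} {G′} 0≤t spanner u~v with multiplicativeSpanner-edge {G = G} {G′} 0≤t spanner u~v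
  ... | zero  , p , _   = contradiction u~v (Graph.~-irrefl G (Path-0⇒≡ G′ p))
  ... | suc m , _ , m≤t = ≤ᴷ-trans (1≤fromℕ {suc m} (s≤s z≤n)) m≤t

  -- The graph with shortcuts, for an arbitrary Δ

  module Construction {n} (G : Graph n) (β : ℕ) {ε t} (0≤ε : 0# ≤ᴷ ε) (ε≤1 : ε ≤ᴷ 1#) (0≤t : 0# ≤ᴷ t)
    (H : EdgeSet n) (hopset : IsHopset K β ε G H)
    (G* : Graph n) (spanner : IsMultiplicativeSpanner K t G G*) (Δ : ℕ) where

    open EdgeSet H
    open Graph G

    private
      D = Δ + Δ
      H? : (uv : Fin n × Fin n) → Dec (proj₁ uv ∈H proj₂ uv)
      H? (u , v) = u ∈H? v
      shortcuts = concatMap (shortPathEdges G D) (filter H? (pairs n))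

    ∈-shortcuts⇒~ : ∀ {u v} → (u , v) ∈ shortcuts → u ~ v
    ∈-shortcuts⇒~ uv∈ =
      let xy , uv∈xy = satisfied (∈-concatMap⁻ (shortPathEdges G D) {xs = filter H? (pairs n)} uv∈) in
      ∈-shortPathEdges⇒~ G D xy uv∈xy

    irrefl-shortcuts : ∀ {u} → ¬ (u , u) ∈ shortcuts
    irrefl-shortcuts = ~-irrefl refl ∘ ∈-shortcuts⇒~

    Ĝ : Graph n
    Ĝ = addEdges G* shortcuts irrefl-shortcuts

    Ĝ⊆G : Ĝ ⊆ᴳ G
    Ĝ⊆G (inj₁ u~v)         = proj₁ spanner u~v
    Ĝ⊆G (inj₂ (inj₁ uv∈)) = ∈-shortcuts⇒~ uv∈
    Ĝ⊆G (inj₂ (inj₂ vu∈)) = ~-sym (∈-shortcuts⇒~ vu∈)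

    ∣Ĝ∣-≤ : ∣ Ĝ ∣ᴳ ≤ 4 * (∣ H ∣ᴴ * Δ + ∣ G* ∣ᴳ)
    ∣Ĝ∣-≤ = ℕ≤.begin
      ∣ Ĝ ∣ᴳ
        ℕ≤.≤⟨ ∣addEdges∣-≤ G* shortcuts irrefl-shortcuts ⟩
      ∣ G* ∣ᴳ + (length shortcuts + length shortcuts)
        ℕ≤.≤⟨ ℕ.+-monoʳ-≤ ∣ G* ∣ᴳ (ℕ.+-mono-≤ shortcuts≤ shortcuts≤) ⟩
      ∣ G* ∣ᴳ + (∣ H ∣ᴴ * D + ∣ H ∣ᴴ * D)
        -- Each pair of `H` costs `4 * Δ`: one factor 2 comes from `D`, the other from the two
        -- orientations. The term `∣ G* ∣ᴳ` is padded to the same coefficient.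
        ℕ≤.≤⟨ ℕ.m≤m+n _ (3 * ∣ G* ∣ᴳ) ⟩
      ∣ G* ∣ᴳ + (∣ H ∣ᴴ * D + ∣ H ∣ᴴ * D) + 3 * ∣ G* ∣ᴳ
        ℕ≤.≡⟨ solve 3 (λ g h d → g :+ (h :* (d :+ d) :+ h :* (d :+ d)) :+ con 3 :* g :=
                                  con 4 :* (h :* d :+ g)) refl ∣ G* ∣ᴳ ∣ H ∣ᴴ Δ ⟩
      4 * (∣ H ∣ᴴ * Δ + ∣ G* ∣ᴳ)
        ℕ≤.∎
      where
      module ℕ≤ = ℕ.≤-Reasoning
      open ℕ-Solver.+-*-Solver
      shortcuts≤ : length shortcuts ≤ ∣ H ∣ᴴ * D
      shortcuts≤ = length-concatMap-≤ (shortPathEdges G D) (length-shortPathEdges G D)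
                     (filter H? (pairs n))

    hopsetEdge-path : ∀ {u v} → u ∈H v → ∀ {k} → k ≤ D → Path G u v k →
                      ∃[ m ] m ≤ k × Path Ĝ u v m
    hopsetEdge-path {u} {v} u∈v = shortPathEdges-path G D Ĝ λ xy∈ → inj₂ (inj₁
      (∈-concatMap⁺ (shortPathEdges G D) (lose (∈-filter⁺ H? (∈-pairs u v) u∈v) xy∈)))

    -- One bound serves both kinds of edge: an edge of `G` costs at most `t` in `G*`, and a hopset
    -- edge of weight at most `D` is realised without error.
    edge-path : ∀ {u v w} → WeightedGraph.Edge (G ∪ H) u v w → w ≤ D →
                Attains (Path Ĝ u v) (fromℕ w +ᴷ t)
    edge-path (inj₁ (u~v , refl)) _ =
      let m , p , m≤t = multiplicativeSpanner-edge {G = G} {G*} 0≤t spanner u~v in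
      m , Path-mono G* Ĝ inj₁ p , (begin
        fromℕ m          ≤⟨ m≤t ⟩
        t                ≤⟨ x≤x+y (0≤fromℕ 1) ⟩
        t +ᴷ fromℕ 1     ≈⟨ +-comm t (fromℕ 1) ⟩
        fromℕ 1 +ᴷ t     ∎)
    edge-path {u} {v} {w} (inj₂ (uv∈H , dist≡w)) w≤D =
      let m , m≤w , p = realise uv∈H in m , p , ≤ᴷ-trans (fromℕ-mono-≤ m≤w) (x≤x+y 0≤t)
      where
      shortest : Path G u v w
      shortest = proj₁ (subst (IsMinimum (Path G u v)) dist≡w
                         (weightedDist-isMinimum (unitWeights G) u v))
      realise : u ∈H v ⊎ v ∈H u → ∃[ m ] m ≤ w × Path Ĝ u v m
      realise (inj₁ u∈v) = hopsetEdge-path u∈v w≤D shortest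
      -- The pair is stored in the opposite direction, so the path is reversed before the shortcut
      -- is used and again afterwards.
      realise (inj₂ v∈u) =
        let m , m≤w , p = hopsetEdge-path v∈u w≤D (reversePath G shortest) in
        m , m≤w , reversePath Ĝ p

    -- Each of the `h` edges contributes an error of at most `t`; no edge weighs more than the whole
    -- walk, so `edge-path` applies to all of them.
    hopWalk-path : ∀ {u v h ℓ} → Walk (G ∪ H) u v h ℓ → ℓ ≤ D →
                   Attains (Path Ĝ u v) (fromℕ ℓ +ᴷ fromℕ h *ᴷ t)
    hopWalk-path [] _ = 0 , (_ , []) , +-nonneg ≤ᴷ-refl (*-nonneg ≤ᴷ-refl 0≤t)
    hopWalk-path (_∷_ {w = w} {h} {ℓ} e p) w+ℓ≤D =
      let m , q , m≤ = edge-path e (ℕ.m+n≤o⇒m≤o w w+ℓ≤D)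
          k , r , k≤ = hopWalk-path p (ℕ.m+n≤o⇒n≤o w w+ℓ≤D)
      in m + k , q ++ʷ r , (begin
        fromℕ (m + k)
          ≈⟨ fromℕ-+ m k ⟩
        fromℕ m +ᴷ fromℕ k
          ≤⟨ +ᴷ-mono-≤ m≤ k≤ ⟩
        fromℕ w +ᴷ t +ᴷ (fromℕ ℓ +ᴷ fromℕ h *ᴷ t)
          ≈⟨ solve 4 (λ w t ℓ h → w :+ t :+ (ℓ :+ h :* t) :=
                                   w :+ ℓ :+ (con 1 :+ h) :* t) ≈-refl
               (fromℕ w) t (fromℕ ℓ) (fromℕ h) ⟩
        fromℕ w +ᴷ fromℕ ℓ +ᴷ fromℕ (suc h) *ᴷ t
          ≈⟨ +-congʳ (fromℕ-+ w ℓ) ⟨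
        fromℕ (w + ℓ) +ᴷ fromℕ (suc h) *ᴷ t
          ∎)
      where open Solver

    short-path : ∀ {k} → k ≤ Δ → ∀ {u v} → Path G u v k →
                 Attains (Path Ĝ u v) ((1# +ᴷ ε) *ᴷ fromℕ k +ᴷ fromℕ β *ᴷ t)
    short-path {k} k≤Δ p with ℓ , (h , h≤β , q) , ℓ≤ ← hopset-path {β = β} {H = H} 0≤ε hopset p =
      Attains-weaken
        (+ᴷ-mono-≤ (≤ᴷ-trans ℓ≤ (≤ᴷ-reflexive (+-identityʳ _)))
                   (*ᴷ-monoˡ-≤ 0≤t (fromℕ-mono-≤ h≤β)))
        (hopWalk-path q (ℕ.≤-trans (fromℕ-cancel-≤ {k = k + k} ℓ≤2k) (ℕ.+-mono-≤ k≤Δ k≤Δ)))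
      where
      open Solver
      -- As `ε` is at most 1, the hopset walk is at most twice as long as the path. Moved back to ℕ,
      -- this gives the bound by `D` that `hopWalk-path` requires.
      ℓ≤2k : fromℕ ℓ ≤ᴷ fromℕ (k + k)
      ℓ≤2k = begin
        fromℕ ℓ                       ≤⟨ ℓ≤ ⟩
        (1# +ᴷ ε) *ᴷ fromℕ k +ᴷ 0#    ≈⟨ solve 2 (λ ε k → (con 1 :+ ε) :* k :+ con 0 :=
                                                          k :+ k :* ε) ≈-refl ε (fromℕ k) ⟩
        fromℕ k +ᴷ fromℕ k *ᴷ ε       ≤⟨ +-monoʳ-≤ _ (*ᴷ-monoʳ-≤ (0≤fromℕ k) ε≤1) ⟩
        fromℕ k +ᴷ fromℕ k *ᴷ 1#      ≈⟨ +-congˡ (*-identityʳ _) ⟩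
        fromℕ k +ᴷ fromℕ k            ≈⟨ fromℕ-+ k k ⟨
        fromℕ (k + k)                 ∎

    -- Walks of arbitrary length, cut into pieces of length Δ

    module _ (1≤Δ : 1 ≤ Δ) (βt≤Δε : fromℕ β *ᴷ t ≤ᴷ fromℕ Δ *ᴷ ε) where

      private
        α = 1# +ᴷ fromℕ 2 *ᴷ ε
        b = fromℕ β *ᴷ t

        -- The stretch exceeds that of the hopset by `ε`. On a path of length `k` the surplus is
        -- `k *ᴷ ε`, which for `k = Δ` pays the additive error `b`.
        α*k≈ : ∀ k → α *ᴷ k ≈ (1# +ᴷ ε) *ᴷ k +ᴷ k *ᴷ ε
        α*k≈ k = solve 2 (λ ε k → (con 1 :+ (con 1 :+ (con 1 :+ con 0)) :* ε) :* k :=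
                                  (con 1 :+ ε) :* k :+ k :* ε) ≈-refl ε k
          where open Solver

      full-piece : ∀ {u v} → Path G u v Δ → Attains (Path Ĝ u v) (α *ᴷ fromℕ Δ)
      full-piece p = Attains-weaken (begin
        (1# +ᴷ ε) *ᴷ fromℕ Δ +ᴷ b             ≤⟨ +-monoʳ-≤ _ βt≤Δε ⟩
        (1# +ᴷ ε) *ᴷ fromℕ Δ +ᴷ fromℕ Δ *ᴷ ε  ≈⟨ α*k≈ (fromℕ Δ) ⟨
        α *ᴷ fromℕ Δ                          ∎) (short-path ℕ.≤-refl p)

      last-piece : ∀ {k} → k ≤ Δ → ∀ {u v} → Path G u v k →
                   Attains (Path Ĝ u v) (α *ᴷ fromℕ k +ᴷ b)
      last-piece {k} k≤Δ p = Attains-weaken (+ᴷ-mono-≤ (begin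
        (1# +ᴷ ε) *ᴷ fromℕ k                    ≤⟨ x≤x+y (*-nonneg (0≤fromℕ k) 0≤ε) ⟩
        (1# +ᴷ ε) *ᴷ fromℕ k +ᴷ fromℕ k *ᴷ ε    ≈⟨ α*k≈ (fromℕ k) ⟨
        α *ᴷ fromℕ k                            ∎) (≤ᴷ-refl {b})) (short-path k≤Δ p)

      Ĝ-path : ∀ {k} → Acc _<_ k → ∀ {u v} → Path G u v k →
               Attains (Path Ĝ u v) (α *ᴷ fromℕ k +ᴷ b)
      Ĝ-path {k} (acc rec) p with ℕ.≤-total k Δ
      ... | inj₁ k≤Δ = last-piece k≤Δ p
      ... | inj₂ Δ≤k with l , refl ← ℕ.m≤n⇒∃[o]m+o≡n Δ≤k =
        let _ , q , r  = splitPath G Δ p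
            m , q′ , m≤ = full-piece q
            -- `1≤Δ` makes the remainder `l` strictly shorter than `Δ + l`. The term `b` enters only
            -- through this recursive call, hence once in total.
            j , r′ , j≤ = Ĝ-path (rec (ℕ.+-monoˡ-≤ l 1≤Δ)) r
        in m + j , q′ ++ʷ r′ , (begin
          fromℕ (m + j)                               ≈⟨ fromℕ-+ m j ⟩
          fromℕ m +ᴷ fromℕ j                          ≤⟨ +ᴷ-mono-≤ m≤ j≤ ⟩
          α *ᴷ fromℕ Δ +ᴷ (α *ᴷ fromℕ l +ᴷ b)         ≈⟨ +-assoc _ _ _ ⟨
          α *ᴷ fromℕ Δ +ᴷ α *ᴷ fromℕ l +ᴷ b           ≈⟨ +-congʳ (distribˡ α _ _) ⟨
          α *ᴷ (fromℕ Δ +ᴷ fromℕ l) +ᴷ b              ≈⟨ +-congʳ (*-congˡ (fromℕ-+ Δ l)) ⟨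
          α *ᴷ fromℕ (Δ + l) +ᴷ b                     ∎)

      Ĝ-isSpanner : IsSpanner K α b G Ĝ
      Ĝ-isSpanner = path⇒spanner G {G′ = Ĝ} Ĝ⊆G (Ĝ-path (<-wellFounded _))

-- Choice of Δ and the final edge count

mainTheorem5 : ∀ {c ℓ₁ ℓ₂} →
    ∃[ C ] ((K : ArchimedeanField c ℓ₁ ℓ₂) → let open ArchimedeanField K in
    ∀ {n} (G : Graph n) (β : ℕ) (ε t : Carrier) →
    1 ≤ β → 0# <ᴷ ε → ε <ᴷ 1# → 0# ≤ᴷ t →
    (H* : EdgeSet n) → IsHopset K β ε G H* →
    (G* : Graph n) → IsMultiplicativeSpanner K t G G* →
    ∃[ Ĝ ] (IsSpanner K (1# +ᴷ fromℕ 2 *ᴷ ε) (fromℕ β *ᴷ t) G Ĝ ×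
    fromℕ ∣ Ĝ ∣ᴳ ≤ᴷ fromℕ C *ᴷ (t *ᴷ fromℕ ∣ H* ∣ᴴ *ᴷ fromℕ β / ε +ᴷ fromℕ ∣ G* ∣ᴳ)))
-- The factor 4 of `∣Ĝ∣-≤` times the factor 2 lost in rounding βt/ε up to Δ.
mainTheorem5 = 8 , proof
  where
  proof : (K : ArchimedeanField _ _ _) → let open ArchimedeanField K in
    ∀ {n} (G : Graph n) (β : ℕ) (ε t : Carrier) →
    1 ≤ β → 0# <ᴷ ε → ε <ᴷ 1# → 0# ≤ᴷ t →
    (H* : EdgeSet n) → IsHopset K β ε G H* →
    (G* : Graph n) → IsMultiplicativeSpanner K t G G* →
    ∃[ Ĝ ] (IsSpanner K (1# +ᴷ fromℕ 2 *ᴷ ε) (fromℕ β *ᴷ t) G Ĝ ×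
    fromℕ ∣ Ĝ ∣ᴳ ≤ᴷ fromℕ 8 *ᴷ (t *ᴷ fromℕ ∣ H* ∣ᴴ *ᴷ fromℕ β / ε +ᴷ fromℕ ∣ G* ∣ᴳ))
  proof K {n} G β ε t 1≤β 0<ε ε<1 0≤t H* hopset G* spanner
    with Fin.any? (λ u → Fin.any? λ v → Graph._~?_ G u v)
  ... | yes (u , v , u~v) = Ĝ , Ĝ-isSpanner (s≤s z≤n) βt≤Δε , size
    where
    open ArchimedeanField K hiding (refl; sym; trans; zero)
    open FieldProperties K
    open PartialOrderReasoning poset
    open Solver using (solve; con; _:+_; _:*_; _:=_)

    b = fromℕ β *ᴷ t
    x = b / ε
    h = fromℕ ∣ H* ∣ᴴ
    g = fromℕ ∣ G* ∣ᴳ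

    1≤b : 1# ≤ᴷ b
    1≤b = begin
      1#            ≤⟨ 1≤stretch K {G = G} {G*} 0≤t spanner u~v ⟩
      t             ≈⟨ *-identityˡ t ⟨
      1# *ᴷ t       ≤⟨ *ᴷ-monoˡ-≤ 0≤t (1≤fromℕ 1≤β) ⟩
      b             ∎

    1≤x : 1# ≤ᴷ x
    1≤x = 1≤y/x 0<ε (proj₁ ε<1) 1≤b

    ⌊x⌋ = floor (≤ᴷ-trans 0≤1 1≤x)
    -- Rounding up gives `βt≤Δε`, and the successor makes Δ visibly positive.
    Δ = suc (proj₁ ⌊x⌋)
    open Construction K G β (proj₁ 0<ε) (proj₁ ε<1) 0≤t H* hopset G* spanner Δ

    βt≤Δε : b ≤ᴷ fromℕ Δ *ᴷ ε
    βt≤Δε = begin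
      b              ≈⟨ y/x*x≈y 0<ε b ⟨
      x *ᴷ ε         ≤⟨ *ᴷ-monoˡ-≤ (proj₁ 0<ε) (proj₂ (proj₂ ⌊x⌋)) ⟩
      fromℕ Δ *ᴷ ε   ∎

    size : fromℕ ∣ Ĝ ∣ᴳ ≤ᴷ fromℕ 8 *ᴷ (t *ᴷ h *ᴷ fromℕ β / ε +ᴷ g)
    size = begin
      fromℕ ∣ Ĝ ∣ᴳ
        ≤⟨ fromℕ-mono-≤ ∣Ĝ∣-≤ ⟩
      fromℕ (4 * (∣ H* ∣ᴴ * Δ + ∣ G* ∣ᴳ))
        ≈⟨ fromℕ-* 4 (∣ H* ∣ᴴ * Δ + ∣ G* ∣ᴳ) ⟩
      fromℕ 4 *ᴷ fromℕ (∣ H* ∣ᴴ * Δ + ∣ G* ∣ᴳ)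
        ≈⟨ *-congˡ (≈-trans (fromℕ-+ (∣ H* ∣ᴴ * Δ) ∣ G* ∣ᴳ) (+-congʳ (fromℕ-* ∣ H* ∣ᴴ Δ))) ⟩
      fromℕ 4 *ᴷ (h *ᴷ fromℕ Δ +ᴷ g)
        -- `fromℕ Δ` unfolds to 1 plus a number at most `x`, so `1≤x` bounds it by `x +ᴷ x`. The
        -- summand `g` is doubled to share the constant.
        ≤⟨ *ᴷ-monoʳ-≤ (0≤fromℕ 4) (+ᴷ-mono-≤
             (*ᴷ-monoʳ-≤ (0≤fromℕ ∣ H* ∣ᴴ) (+ᴷ-mono-≤ 1≤x (proj₁ (proj₂ ⌊x⌋))))
             (x≤x+y (0≤fromℕ ∣ G* ∣ᴳ))) ⟩
      fromℕ 4 *ᴷ (h *ᴷ (x +ᴷ x) +ᴷ (g +ᴷ g))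
        ≈⟨ solve 6 (λ c h β t ε⁻¹ g →
             c :* (h :* (β :* t :* ε⁻¹ :+ β :* t :* ε⁻¹) :+ (g :+ g)) :=
             (c :+ c) :* (t :* h :* β :* ε⁻¹ :+ g)) ≈-refl
             (fromℕ 4) h (fromℕ β) t (ε ⁻¹) g ⟩
      (fromℕ 4 +ᴷ fromℕ 4) *ᴷ (t *ᴷ h *ᴷ fromℕ β / ε +ᴷ g)
        ≈⟨ *-congʳ (fromℕ-+ 4 4) ⟨
      fromℕ 8 *ᴷ (t *ᴷ h *ᴷ fromℕ β / ε +ᴷ g)
        ∎
  -- Here t may be less than 1, and then Δ need not be bounded by a multiple of βt/ε.
  ... | no noEdge = G , path⇒spanner K G {G′ = G} id (λ {_} {_} {k} p → k , p , k≤ k) , size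
    where
    open ArchimedeanField K hiding (refl; sym; trans; zero)
    open FieldProperties K
    open PartialOrderReasoning poset

    k≤ : ∀ k → fromℕ k ≤ᴷ (1# +ᴷ fromℕ 2 *ᴷ ε) *ᴷ fromℕ k +ᴷ fromℕ β *ᴷ t
    k≤ k = begin
      fromℕ k        ≈⟨ *-identityˡ _ ⟨
      1# *ᴷ fromℕ k
        ≤⟨ *ᴷ-monoˡ-≤ (0≤fromℕ k) (x≤x+y (*-nonneg (0≤fromℕ 2) (proj₁ 0<ε))) ⟩
      (1# +ᴷ fromℕ 2 *ᴷ ε) *ᴷ fromℕ k
        ≤⟨ x≤x+y (*-nonneg (0≤fromℕ β) 0≤t) ⟩
      (1# +ᴷ fromℕ 2 *ᴷ ε) *ᴷ fromℕ k +ᴷ fromℕ β *ᴷ t  ∎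

    size : fromℕ ∣ G ∣ᴳ ≤ᴷ fromℕ 8 *ᴷ (t *ᴷ fromℕ ∣ H* ∣ᴴ *ᴷ fromℕ β / ε +ᴷ fromℕ ∣ G* ∣ᴳ)
    size = begin
      fromℕ ∣ G ∣ᴳ
        -- Without edges the empty list is a cover, and `fromℕ 0` is `0#` by definition.
        ≤⟨ fromℕ-mono-≤ (⊆⇒∣∣-≤ G {es = []} λ {u} {v} _ u~v → contradiction (u , v , u~v) noEdge) ⟩
      0#
        ≤⟨ *-nonneg (0≤fromℕ 8) (+-nonneg (*-nonneg (*-nonneg (*-nonneg 0≤t (0≤fromℕ ∣ H* ∣ᴴ))
             (0≤fromℕ β)) (0≤x⁻¹ 0<ε)) (0≤fromℕ ∣ G* ∣ᴳ)) ⟩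
      fromℕ 8 *ᴷ (t *ᴷ fromℕ ∣ H* ∣ᴴ *ᴷ fromℕ β / ε +ᴷ fromℕ ∣ G* ∣ᴳ)
        ∎
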